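{- The following bounds hold: (a) $r_k(k+1, 3; P_n) \le 16n$ for all integers $n \ge k \ge 3$; (b) $2n-2 \le r_3(4,3; P_n) \le 3n-4$ for all integers $n \ge 3$; (c) $r_4(5, 4; P_n) \ge 2^{n-2}+1$ for all integers $n\ge 2$.
   Context: For $k\ge 2$, the $k$-uniform tight path $P_n$ has vertices $v_1<\cdots<v_n$ and edges $\{v_j,\dots,v_{j+k-1}\}$ for $j=1,\dots,n-k+1$ (no edges if $n<k$); in a red/blue coloring of the $k$-subsets of $[N]$, a blue copy of $P_n$ is a sequence $x_1<\cdots<x_n$ in $[N]$ with every $k$-set $\{x_j,\dots,x_{j+k-1}\}$ blue. For integers $k\ge 2$, $s>k$, $t\ge 1$ and $n\ge 1$, $r_k(s,t;P_n)$ is the minimum $N$ such that every red/blue coloring of the $k$-subsets of $[N]$ contains a blue copy of $P_n$ or a set of $s$ vertices containing at least $t$ red $k$-subsets. -}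

module Defs where

open import Data.Nat using (ℕ; _+_; _≤_; _<_)
import Data.Nat.Properties as ℕP
open import Data.Fin using (Fin; toℕ)
import Data.Fin as F
import Data.Fin.Properties as FP
open import Data.Fin.Subset using (Subset; _⊆_; ∣_∣)
open import Data.Vec using (tabulate)
open import Data.List using (List; length)
open import Data.List.Relation.Unary.All using (All)
open import Data.List.Relation.Unary.Unique.Propositional using (Unique)
open import Data.Product using (Σ; _×_; ∃)
open import Data.Sum using (_⊎_)
open import Relation.Nullary using (does; ¬_)
open import Relation.Nullary.Decidable using (_×-dec_)
open import Relation.Binary.PropositionalEquality using (_≡_)

data Colour : Set where
  red blue : Colour

-- A red/blue colouring of the k-subsets of [N]; vertex set [N] is Fin N
-- (ordered by toℕ).  The value on subsets of size ≠ k is irrelevant.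
Colouring : ℕ → Set
Colouring N = Subset N → Colour

Increasing : ∀ {n N} → (Fin n → Fin N) → Set
Increasing {n} x = ∀ (i j : Fin n) → i F.< j → x i F.< x j

window : ∀ {n N} (k : ℕ) → (Fin n → Fin N) → ℕ → Subset N
window {n} k x j = tabulate λ v →
  does (FP.any? λ (i : Fin n) →
    (j ℕP.≤? toℕ i) ×-dec ((toℕ i ℕP.<? j + k) ×-dec (x i FP.≟ v)))

BluePath : ∀ {N} (k n : ℕ) → Colouring N → Set
BluePath {N} k n χ =
  Σ (Fin n → Fin N) λ x → Increasing x ×
    (∀ (j : ℕ) → j + k ≤ n → χ (window k x j) ≡ blue)

RedDense : ∀ {N} (k s t : ℕ) → Colouring N → Set
RedDense {N} k s t χ =
  Σ (Subset N) λ S → ∣ S ∣ ≡ s ×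
    Σ (List (Subset N)) λ L → Unique L × t ≤ length L ×
      All (λ T → T ⊆ S × ∣ T ∣ ≡ k × χ T ≡ red) L

Arrows : (k s t n N : ℕ) → Set
Arrows k s t n N = ∀ (χ : Colouring N) → BluePath k n χ ⊎ RedDense k s t χ

-- r_k(s,t;Pₙ) ≤ M  (the minimum N with Arrows is at most M)
r≤ : (k s t n M : ℕ) → Set
r≤ k s t n M = Σ ℕ λ N → N ≤ M × Arrows k s t n N

r≥ : (k s t n M : ℕ) → Set
r≥ k s t n M = ∀ N → N < M → ¬ Arrows k s t n N

{-# OPTIONS --safe #-}
-- Upper bounds: build the blue path from right to left, keeping a path W with two possible next
-- vertices q < q′.  With X the first k - 2 vertices of W, a new vertex r can be prepended to
-- q ∷ W or to q′ ∷ W, unless r ∷ q ∷ X and r ∷ q′ ∷ X are both red; but then every other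
-- k-subset of r , q , q′ , X is blue and r ∷ q ∷ q′ ∷ W is a blue path.  Among three new vertices
-- two can precede q or two can precede q′, and either pair gives a longer W with two options.  So
-- each further path vertex costs three vertices, and 3n - 2k + 1 vertices suffice.
--
-- Lower bound for k = 3: a < b < c is red iff a and b lie in the same block {2i , 2i + 1}, so all
-- but the last vertex of a blue path lie in distinct blocks.
-- Lower bound for k = 4: join two copies of the colouring of half the size, a crossing 4-set being
-- red iff it has two vertices on each side; a blue path then has at most one vertex in one of the
-- halves, so doubling the vertex set lengthens blue paths by at most one.
module Submission where

open import Defs
open import Data.Nat using (ℕ; _+_; _*_; _∸_; _^_; _≤_; suc)
open import Data.Product using (_×_)
open import Data.Bool using (true; false; if_then_else_; _∧_; not)
open import Data.Fin using (Fin; zero; suc; toℕ; fromℕ<)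
import Data.Fin as F
import Data.Fin.Properties as FP
open import Data.Fin.Subset using (Subset; _⊆_; ∣_∣; _∈_; _∉_; _∪_; ⁅_⁆; ⊥; inside; outside)
open import Data.Fin.Subset.Properties
  using (⊆-antisym; drop-∷-⊆; x∈p∪q⁺; x∈p∪q⁻; x∈⁅x⁆; x∈⁅y⁆⇒x≡y; ∉⊥; ∣⊥∣≡0; ∪-identityˡ)
open import Data.List using (List; []; _∷_; length; lookup; take; drop; map; filter; applyUpTo)
open import Data.List.Membership.Propositional using () renaming (_∈_ to _∈ₗ_)
open import Data.List.Membership.Propositional.Properties
  using (∈-lookup; ∈-map⁺; ∈-map⁻; ∈-filter⁺; ∈-applyUpTo⁺; ∈-applyUpTo⁻)
open import Data.List.Membership.Setoid.Properties using (index-injective)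
open import Data.List.Properties using (length-map; length-take)
open import Data.List.Relation.Binary.Pointwise using (Pointwise-≡⇒≡)
open import Data.List.Relation.Binary.Sublist.Propositional
  using ([]; _∷_; _∷ʳ_; ⊆-refl) renaming (_⊆_ to _⊆ₗ_; lookup to ⊆-lookup)
open import Data.List.Relation.Binary.Sublist.Propositional.Properties
  using (map⁺; take⁺; to-≋; All-resp-⊆)
open import Data.List.Relation.Unary.All using (All; []; _∷_)
import Data.List.Relation.Unary.All as All
import Data.List.Relation.Unary.All.Properties as AllP
open import Data.List.Relation.Unary.AllPairs using (AllPairs; []; _∷_)
import Data.List.Relation.Unary.AllPairs as AllPairs
import Data.List.Relation.Unary.AllPairs.Properties as AllPairsP
open import Data.List.Relation.Unary.Any using (here; there; index)
open import Data.List.Relation.Unary.Unique.Propositional using (Unique)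
import Data.List.Relation.Unary.Unique.Propositional.Properties as UniqueP
open import Data.Nat
  using (zero; 2+; _<_; _<?_; _≟_; z≤n; s≤s; s≤s⁻¹; z<s; s<s; ⌊_/2⌋; ⌈_/2⌉)
open import Data.Nat.ListAction using (sum)
import Data.Nat.Properties as ℕP
open import Data.Nat.Tactic.RingSolver using (solve-∀)
open import Data.Product using (Σ; _,_; ∃₂; ∃-syntax)
open import Data.Sum using (_⊎_; inj₁; inj₂)
import Data.Sum as Sum
open import Data.Vec using ([]; _∷_; here; there)
open import Data.Vec.Properties using (lookup⇒[]=; []=⇒lookup; lookup∘tabulate)
open import Function using (_∘_)
open import Relation.Binary.PropositionalEquality
open import Relation.Nullary using (Dec; yes; no; does; ¬_; contradiction)
open import Relation.Nullary.Decidable using (dec-true; dec-false)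

private variable
  n N k m p : ℕ

-- Windows and vertex sets as lists

does-true : ∀ {P : Set} (d : Dec P) → does d ≡ true → P
does-true (yes p) _ = p

module _ {n N : ℕ} {x : Fin n → Fin N} {j : ℕ} {v : Fin N} where

  ∈-window⁺ : ∀ {i} → j ≤ toℕ i → toℕ i < j + k → x i ≡ v → v ∈ window k x j
  ∈-window⁺ {i = i} j≤i i<j+k xi≡v = lookup⇒[]= v _
    (trans (lookup∘tabulate _ v) (dec-true (FP.any? _) (i , j≤i , i<j+k , xi≡v)))

  ∈-window⁻ : v ∈ window k x j → ∃[ i ] (j ≤ toℕ i × toℕ i < j + k × x i ≡ v)
  ∈-window⁻ v∈ = does-true (FP.any? _) (trans (sym (lookup∘tabulate _ v)) ([]=⇒lookup v∈))

fromList : List (Fin N) → Subset N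
fromList []       = ⊥
fromList (x ∷ xs) = ⁅ x ⁆ ∪ fromList xs

∈-fromList⁺ : ∀ {v} {xs : List (Fin N)} → v ∈ₗ xs → v ∈ fromList xs
∈-fromList⁺ {xs = x ∷ xs} (here refl) = x∈p∪q⁺ (inj₁ (x∈⁅x⁆ x))
∈-fromList⁺ {xs = x ∷ xs} (there v∈)  = x∈p∪q⁺ (inj₂ (∈-fromList⁺ v∈))

∈-fromList⁻ : ∀ {v} (xs : List (Fin N)) → v ∈ fromList xs → v ∈ₗ xs
∈-fromList⁻ []       v∈ = contradiction v∈ ∉⊥
∈-fromList⁻ (x ∷ xs) v∈ with x∈p∪q⁻ ⁅ x ⁆ (fromList xs) v∈
... | inj₁ v∈x  = here (x∈⁅y⁆⇒x≡y x v∈x)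
... | inj₂ v∈xs = there (∈-fromList⁻ xs v∈xs)

∣⁅x⁆∪p∣≡1+∣p∣ : (x : Fin N) (p : Subset N) → x ∉ p → ∣ ⁅ x ⁆ ∪ p ∣ ≡ suc ∣ p ∣
∣⁅x⁆∪p∣≡1+∣p∣ zero    (inside  ∷ p) x∉p = contradiction here x∉p
∣⁅x⁆∪p∣≡1+∣p∣ zero    (outside ∷ p) x∉p = cong (suc ∘ ∣_∣) (∪-identityˡ p)
∣⁅x⁆∪p∣≡1+∣p∣ (suc x) (inside  ∷ p) x∉p = cong suc (∣⁅x⁆∪p∣≡1+∣p∣ x p (x∉p ∘ there))
∣⁅x⁆∪p∣≡1+∣p∣ (suc x) (outside ∷ p) x∉p = ∣⁅x⁆∪p∣≡1+∣p∣ x p (x∉p ∘ there)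

∣fromList∣ : {xs : List (Fin N)} → Unique xs → ∣ fromList xs ∣ ≡ length xs
∣fromList∣ {N} []               = ∣⊥∣≡0 N
∣fromList∣ {xs = x ∷ xs} (x∉xs ∷ xs!) = trans
  (∣⁅x⁆∪p∣≡1+∣p∣ x _ λ x∈ → All.lookup x∉xs (∈-fromList⁻ xs x∈) refl)
  (cong suc (∣fromList∣ xs!))

∈-take-drop⁺ : (xs : List (Fin N)) (j k : ℕ) {i : Fin (length xs)} →
               j ≤ toℕ i → toℕ i < j + k → lookup xs i ∈ₗ take k (drop j xs)
∈-take-drop⁺ (x ∷ xs) zero    (suc k) {zero}  _   _        = here refl
∈-take-drop⁺ (x ∷ xs) zero    (suc k) {suc i} _   (s≤s i<) = there (∈-take-drop⁺ xs zero k z≤n i<)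
∈-take-drop⁺ (x ∷ xs) (suc j) k       {suc i} (s≤s j≤i) (s≤s i<) = ∈-take-drop⁺ xs j k j≤i i<

∈-take-drop⁻ : ∀ (xs : List (Fin N)) (j k : ℕ) {v} → v ∈ₗ take k (drop j xs) →
               ∃[ i ] (j ≤ toℕ i × toℕ i < j + k × lookup xs i ≡ v)
∈-take-drop⁻ []       zero    (suc k) ()
∈-take-drop⁻ []       (suc j) (suc k) ()
∈-take-drop⁻ (x ∷ xs) zero    (suc k) (here v≡x)  = zero , z≤n , z<s , sym v≡x
∈-take-drop⁻ (x ∷ xs) zero    (suc k) (there v∈) with ∈-take-drop⁻ xs zero k v∈
... | i , _ , i<k , eq = suc i , z≤n , s<s i<k , eq
∈-take-drop⁻ (x ∷ xs) (suc j) k       v∈ with ∈-take-drop⁻ xs j k v∈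
... | i , j≤i , i<j+k , eq = suc i , s≤s j≤i , s<s i<j+k , eq

-- Turns the positional windows of `BluePath` into prefixes of suffixes, a form that suits recursion
-- on a path growing at its front.
window-lookup : (k j : ℕ) (xs : List (Fin N)) → window k (lookup xs) j ≡ fromList (take k (drop j xs))
window-lookup k j xs = ⊆-antisym
  (λ v∈ → to (∈-window⁻ v∈))
  (λ v∈ → from (∈-take-drop⁻ xs j k (∈-fromList⁻ _ v∈)))
  where
  to : ∀ {v} → ∃[ i ] (j ≤ toℕ i × toℕ i < j + k × lookup xs i ≡ v) → v ∈ fromList (take k (drop j xs))
  to (i , j≤i , i<j+k , refl) = ∈-fromList⁺ (∈-take-drop⁺ xs j k j≤i i<j+k)
  from : ∀ {v} → ∃[ i ] (j ≤ toℕ i × toℕ i < j + k × lookup xs i ≡ v) → v ∈ window k (lookup xs) j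
  from (i , j≤i , i<j+k , eq) = ∈-window⁺ j≤i i<j+k eq

lookup-increasing : {xs : List (Fin N)} → AllPairs F._<_ xs → Increasing (lookup xs)
lookup-increasing (x<xs ∷ _) zero    (suc j) _       = All.lookup x<xs (∈-lookup j)
lookup-increasing (_ ∷ xs<)  (suc i) (suc j) (s≤s i<j) = lookup-increasing xs< i j i<j

fresh : ∀ {v} {xs : List (Fin N)} → All (v F.<_) xs → ¬ v ∈ₗ xs
fresh v<xs v∈ = FP.<-irrefl refl (All.lookup v<xs v∈)

increasing⇒unique : {xs : List (Fin N)} → AllPairs F._<_ xs → Unique xs
increasing⇒unique = AllPairs.map FP.<⇒≢

AllPairs-resp-⊆ : ∀ {A : Set} {R : A → A → Set} {xs ys : List A} →
                  xs ⊆ₗ ys → AllPairs R ys → AllPairs R xs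
AllPairs-resp-⊆ []           []        = []
AllPairs-resp-⊆ (y ∷ʳ xs⊆)   (_ ∷ ys~) = AllPairs-resp-⊆ xs⊆ ys~
AllPairs-resp-⊆ (refl ∷ xs⊆) (y~ ∷ ys~) = All-resp-⊆ xs⊆ y~ ∷ AllPairs-resp-⊆ xs⊆ ys~

fromList-mono : {xs ys : List (Fin N)} → (∀ {v} → v ∈ₗ xs → v ∈ₗ ys) → fromList xs ⊆ fromList ys
fromList-mono {xs = xs} xs⊆ys v∈ = ∈-fromList⁺ (xs⊆ys (∈-fromList⁻ xs v∈))

fromList-≢ : {xs ys : List (Fin N)} → ∃[ v ] (v ∈ₗ xs × ¬ v ∈ₗ ys) → fromList xs ≢ fromList ys
fromList-≢ {ys = ys} (v , v∈ , v∉) eq = v∉ (∈-fromList⁻ ys (subst (v ∈_) eq (∈-fromList⁺ v∈)))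

colour? : (c : Colour) → c ≡ red ⊎ c ≡ blue
colour? red  = inj₁ refl
colour? blue = inj₂ refl

-- Blue paths grown by prepending vertices

module _ {N : ℕ} (k : ℕ) (χ : Colouring N) where

  -- For k = 3 + h the prefix computes: `Blue (r ∷ q ∷ W)` is already a statement about
  -- `r ∷ q ∷ take (suc h) W`.
  Blue : List (Fin N) → Set
  Blue xs = χ (fromList (take k xs)) ≡ blue

  -- Blueness is asked only from length k on, so that short increasing lists can start the
  -- construction whatever the colours.
  data Path : List (Fin N) → Set where
    []   : Path []
    step : ∀ {x xs} → All (x F.<_) xs → (k ≤ length (x ∷ xs) → Blue (x ∷ xs)) → Path xs → Path (x ∷ xs)

module _ {N h : ℕ} {χ : Colouring N} where

  private
    k₀ : ℕ
    k₀ = 3 + h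

  Path-increasing : ∀ {xs} → Path k₀ χ xs → AllPairs F._<_ xs
  Path-increasing []              = []
  Path-increasing (step x<xs _ P) = x<xs ∷ Path-increasing P

  Path-blue : ∀ {xs} → Path k₀ χ xs → ∀ j → j + k₀ ≤ length xs → Blue k₀ χ (drop j xs)
  Path-blue (step _ b _) zero    k≤         = b k≤
  Path-blue (step _ _ P) (suc j) (s≤s j+k≤) = Path-blue P j j+k≤

  Path⇒BluePath : ∀ {xs} → Path k₀ χ xs → n ≤ length xs → BluePath k₀ n χ
  Path⇒BluePath {xs = xs} P n≤ with ℕP.m≤n⇒m<n∨m≡n n≤
  Path⇒BluePath {xs = []}    _            _ | inj₁ ()
  Path⇒BluePath {xs = _ ∷ _} (step _ _ P) _ | inj₁ n<   = Path⇒BluePath P (s≤s⁻¹ n<)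
  Path⇒BluePath {xs = xs}    P            _ | inj₂ refl =
    lookup xs , lookup-increasing (Path-increasing P) , λ j j+k≤ →
      trans (cong χ (window-lookup k₀ j xs)) (Path-blue P j j+k≤)

  extend : ∀ {r q xs} → r F.< q → Path k₀ χ (q ∷ xs) → Blue k₀ χ (r ∷ q ∷ xs) →
           Path k₀ χ (r ∷ q ∷ xs)
  extend r<q P@(step q<xs _ _) b = step (r<q ∷ All.map (FP.<-trans r<q) q<xs) (λ _ → b) P

  extend-short : ∀ {x xs} → All (x F.<_) xs → length xs < 2 + h → Path k₀ χ xs → Path k₀ χ (x ∷ xs)
  extend-short x<xs short = step x<xs λ k≤ → contradiction k≤ (ℕP.<⇒≱ (s<s short))

  -- Upper bound: forks and their extension

  RedSublist : List (Fin N) → List (Fin N) → Set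
  RedSublist ys xs = xs ⊆ₗ ys × length xs ≡ k₀ × χ (fromList xs) ≡ red

  -- Two of the sets are told apart by a vertex of the earlier one missing from the later one; one
  -- direction suffices.
  three-red : ∀ {ys xs₁ xs₂ xs₃} → AllPairs F._<_ ys → length ys ≡ suc k₀ →
              RedSublist ys xs₁ → RedSublist ys xs₂ → RedSublist ys xs₃ →
              ∃[ v ] (v ∈ₗ xs₁ × ¬ v ∈ₗ xs₂) → ∃[ v ] (v ∈ₗ xs₁ × ¬ v ∈ₗ xs₃) →
              ∃[ v ] (v ∈ₗ xs₂ × ¬ v ∈ₗ xs₃) →
              RedDense k₀ (suc k₀) 3 χ
  three-red {ys} ys< ∣ys∣ R₁ R₂ R₃ 1⊈2 1⊈3 2⊈3 =
    fromList ys , trans (∣fromList∣ (increasing⇒unique ys<)) ∣ys∣ , _ ,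
    (fromList-≢ 1⊈2 ∷ fromList-≢ 1⊈3 ∷ []) ∷ (fromList-≢ 2⊈3 ∷ []) ∷ [] ∷ [] , ℕP.≤-refl ,
    red-subset R₁ ∷ red-subset R₂ ∷ red-subset R₃ ∷ []
    where
    red-subset : ∀ {xs} → RedSublist ys xs →
                 fromList xs ⊆ fromList ys × ∣ fromList xs ∣ ≡ k₀ × χ (fromList xs) ≡ red
    red-subset (xs⊆ys , ∣xs∣ , isRed) = fromList-mono (⊆-lookup xs⊆ys) ,
      trans (∣fromList∣ (increasing⇒unique (AllPairs-resp-⊆ xs⊆ys ys<))) ∣xs∣ , isRed

  -- The two ways for `r` to reach `q′ ∷ W`: directly, or with `q` in between. The second records
  -- that `q ∷ q′ ∷ W` is blue, so `q` itself is then available as a predecessor of `q′`.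
  ViaFar : List (Fin N) → (q q′ r : Fin N) → Set
  ViaFar W q q′ r = Blue k₀ χ (r ∷ q′ ∷ W) ⊎ (Blue k₀ χ (q ∷ q′ ∷ W) × Blue k₀ χ (r ∷ q ∷ q′ ∷ W))

  -- If r ∷ q ∷ X and r ∷ q′ ∷ X are both red, they use up the two red k-subsets allowed in
  -- r ∷ q ∷ q′ ∷ X, so the windows of r ∷ q ∷ q′ ∷ W are blue.
  classify : ∀ {W q q′ r} → suc h ≤ length W → AllPairs F._<_ (r ∷ q ∷ q′ ∷ W) →
             RedDense k₀ (suc k₀) 3 χ ⊎ (Blue k₀ χ (r ∷ q ∷ W) ⊎ ViaFar W q q′ r)
  classify {W} {q} {q′} {r} h<∣W∣ (r<@(r<q ∷ _) ∷ q< ∷ q′< ∷ W<) = go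
    (colour? (χ (fromList (r ∷ q ∷ X)))) (colour? (χ (fromList (r ∷ q′ ∷ X))))
    (colour? (χ (fromList (q ∷ q′ ∷ X)))) (colour? (χ (fromList (r ∷ q ∷ q′ ∷ take h W))))
    where
    -- `X` has k - 2 vertices, so `r ∷ q ∷ q′ ∷ X` has k + 1. A window that contains all of `r`,
    -- `q`, `q′` has room for only `h` entries of `W`.
    X = take (suc h) W
    ∣X∣ : length X ≡ suc h
    ∣X∣ = trans (length-take (suc h) W) (ℕP.m≤n⇒m⊓n≡m h<∣W∣)
    ∣A∣ : length (take h W) ≡ h
    ∣A∣ = trans (length-take h W) (ℕP.m≤n⇒m⊓n≡m (ℕP.<⇒≤ h<∣W∣))
    sorted : AllPairs F._<_ (r ∷ q ∷ q′ ∷ X)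
    sorted = AllPairsP.take⁺ (4 + h) (r< ∷ q< ∷ q′< ∷ W<)
    r∉ : ¬ r ∈ₗ q ∷ q′ ∷ X
    r∉ = fresh (AllPairs.head sorted)
    q∉ : ¬ q ∈ₗ q′ ∷ X
    q∉ = fresh (AllPairs.head (AllPairs.tail sorted))
    q′∉ : ¬ q′ ∈ₗ X
    q′∉ = fresh (AllPairs.head (AllPairs.tail (AllPairs.tail sorted)))
    q∉₂ : ¬ q ∈ₗ r ∷ q′ ∷ X
    q∉₂ (here refl) = FP.<-irrefl refl r<q
    q∉₂ (there q∈)  = q∉ q∈
    q′∉₁ : ¬ q′ ∈ₗ r ∷ q ∷ X
    q′∉₁ (here refl)          = r∉ (there (here refl))
    q′∉₁ (there (here refl))  = q∉ (here refl)
    q′∉₁ (there (there q′∈)) = q′∉ q′∈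
    go : χ (fromList (r ∷ q ∷ X)) ≡ red ⊎ χ (fromList (r ∷ q ∷ X)) ≡ blue →
         χ (fromList (r ∷ q′ ∷ X)) ≡ red ⊎ χ (fromList (r ∷ q′ ∷ X)) ≡ blue →
         χ (fromList (q ∷ q′ ∷ X)) ≡ red ⊎ χ (fromList (q ∷ q′ ∷ X)) ≡ blue →
         χ (fromList (r ∷ q ∷ q′ ∷ take h W)) ≡ red ⊎ χ (fromList (r ∷ q ∷ q′ ∷ take h W)) ≡ blue →
         RedDense k₀ (suc k₀) 3 χ ⊎ (Blue k₀ χ (r ∷ q ∷ W) ⊎ ViaFar W q q′ r)
    go (inj₂ b) _ _ _ = inj₂ (inj₁ b)
    go (inj₁ _) (inj₂ b) _ _ = inj₂ (inj₂ (inj₁ b))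
    go (inj₁ _) (inj₁ _) (inj₂ b₃) (inj₂ b₄) = inj₂ (inj₂ (inj₂ (b₃ , b₄)))
    go (inj₁ r₁) (inj₁ r₂) (inj₁ r₃) _ = inj₁ (three-red sorted (cong (3 +_) ∣X∣)
      (refl ∷ refl ∷ q′ ∷ʳ ⊆-refl , cong (2 +_) ∣X∣ , r₁)
      (refl ∷ q ∷ʳ refl ∷ ⊆-refl , cong (2 +_) ∣X∣ , r₂)
      (r ∷ʳ refl ∷ refl ∷ ⊆-refl , cong (2 +_) ∣X∣ , r₃)
      (q , there (here refl) , q∉₂) (r , here refl , r∉) (r , here refl , r∉))
    go (inj₁ r₁) (inj₁ r₂) (inj₂ _) (inj₁ r₄) = inj₁ (three-red sorted (cong (3 +_) ∣X∣)
      (refl ∷ refl ∷ refl ∷ take⁺ (ℕP.n≤1+n h) , cong (3 +_) ∣A∣ , r₄)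
      (refl ∷ refl ∷ q′ ∷ʳ ⊆-refl , cong (2 +_) ∣X∣ , r₁)
      (refl ∷ q ∷ʳ refl ∷ ⊆-refl , cong (2 +_) ∣X∣ , r₂)
      (q′ , there (there (here refl)) , q′∉₁) (q , there (here refl) , q∉₂) (q , there (here refl) , q∉₂))

  -- The vertices below p are still unused.
  record Fork (m p : ℕ) : Set where
    constructor fork
    field
      W     : List (Fin N)
      q q′  : Fin N
      long  : suc h ≤ length W
      m≤∣W∣ : m ≤ length W
      p≤q   : p ≤ toℕ q
      q<q′  : q F.< q′
      near  : Path k₀ χ (q ∷ W)
      far   : Path k₀ χ (q′ ∷ W)

  module _ (F : Fork m n) where
    open Fork F

    classifyFork : ∀ {r} → r F.< q → RedDense k₀ (suc k₀) 3 χ ⊎ (Blue k₀ χ (r ∷ q ∷ W) ⊎ ViaFar W q q′ r)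
    classifyFork r<q = classify long
      ((r<q ∷ FP.<-trans r<q q<q′ ∷ All.map (FP.<-trans r<q) q<W) ∷ (q<q′ ∷ q<W) ∷ Path-increasing far)
      where q<W = AllPairs.head (Path-increasing near)

    forkNear : ∀ {r s} → s F.< r → r F.< q → p ≤ toℕ s →
               Blue k₀ χ (r ∷ q ∷ W) → Blue k₀ χ (s ∷ q ∷ W) → Fork (suc m) p
    forkNear s<r r<q p≤s b c = fork (q ∷ W) _ _ (ℕP.m≤n⇒m≤1+n long) (s≤s m≤∣W∣) p≤s s<r
      (extend (FP.<-trans s<r r<q) near c) (extend r<q near b)

    -- In the mixed cases one new vertex precedes `q′` directly; `q`, which also precedes `q′`,
    -- becomes the larger option, and the other new vertex is skipped.
    forkFar : ∀ {r s} → s F.< r → r F.< q → p ≤ toℕ s →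
              ViaFar W q q′ r → ViaFar W q q′ s → Fork (suc m) p
    forkFar s<r r<q p≤s (inj₁ b) (inj₁ c) =
      fork (q′ ∷ W) _ _ (ℕP.m≤n⇒m≤1+n long) (s≤s m≤∣W∣) p≤s s<r
        (extend (FP.<-trans (FP.<-trans s<r r<q) q<q′) far c) (extend (FP.<-trans r<q q<q′) far b)
    forkFar s<r r<q p≤s (inj₁ b) (inj₂ (c , _)) =
      fork (q′ ∷ W) _ _ (ℕP.m≤n⇒m≤1+n long) (s≤s m≤∣W∣) (ℕP.≤-trans p≤s (ℕP.<⇒≤ s<r)) r<q
        (extend (FP.<-trans r<q q<q′) far b) (extend q<q′ far c)
    forkFar s<r r<q p≤s (inj₂ (b , _)) (inj₁ c) =
      fork (q′ ∷ W) _ _ (ℕP.m≤n⇒m≤1+n long) (s≤s m≤∣W∣) p≤s (FP.<-trans s<r r<q)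
        (extend (FP.<-trans (FP.<-trans s<r r<q) q<q′) far c) (extend q<q′ far b)
    -- Both new vertices pass through `q`, so `W` gains `q` and `q′` at once; this is why `m≤∣W∣` is
    -- only an inequality.
    forkFar s<r r<q p≤s (inj₂ (b , b′)) (inj₂ (_ , c)) =
      fork (q ∷ q′ ∷ W) _ _ (ℕP.m≤n⇒m≤1+n (ℕP.m≤n⇒m≤1+n long)) (s≤s (ℕP.m≤n⇒m≤1+n m≤∣W∣)) p≤s s<r
        (extend (FP.<-trans s<r r<q) q∷far c) (extend r<q q∷far b′)
      where q∷far = extend q<q′ far b

    -- Every blue outcome for `r` adds at least two vertices to `W`: `r` with one of `q` and `q′`,
    -- or all three.
    finishFork : ∀ {r} → r F.< q → RedDense k₀ (suc k₀) 3 χ ⊎ BluePath k₀ (2 + m) χ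
    finishFork r<q = Sum.map₂ (λ where
      (inj₁ b)              → Path⇒BluePath (extend r<q near b) (s≤s (s≤s m≤∣W∣))
      (inj₂ (inj₁ b))       → Path⇒BluePath (extend (FP.<-trans r<q q<q′) far b) (s≤s (s≤s m≤∣W∣))
      (inj₂ (inj₂ (b , c))) → Path⇒BluePath (extend r<q (extend q<q′ far b) c)
                                            (s≤s (s≤s (ℕP.m≤n⇒m≤1+n m≤∣W∣))))
      (classifyFork r<q)

  Fork-< : Fork m p → p < N
  Fork-< F = ℕP.≤-<-trans p≤q (FP.toℕ<n q) where open Fork F

  vertex-below : ∀ {i} (F : Fork m p) → i < p → Σ (Fin N) λ v → toℕ v ≡ i × v F.< Fork.q F
  vertex-below {i = i} F i<p = fromℕ< i<N , FP.toℕ-fromℕ< i<N ,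
      ℕP.<-≤-trans (subst (_< _) (sym (FP.toℕ-fromℕ< i<N)) i<p) (Fork.p≤q F)
    where i<N = ℕP.<-trans i<p (Fork-< F)

  advance : Fork m (3 + p) → RedDense k₀ (suc k₀) 3 χ ⊎ Fork (suc m) p
  advance {p = p} F
    with vertex-below F (ℕP.n<1+n (2 + p)) | vertex-below F (ℕP.m<n+m (1 + p) {2} z<s)
       | vertex-below F (ℕP.m<n+m p {3} z<s)
  ... | a , ≡a , a<q | b , ≡b , b<q | c , ≡c , c<q
    with classifyFork F a<q | classifyFork F b<q | classifyFork F c<q
  ... | inj₁ R | _ | _ = inj₁ R
  ... | inj₂ _ | inj₁ R | _ = inj₁ R
  ... | inj₂ _ | inj₂ _ | inj₁ R = inj₁ R
  ... | inj₂ A | inj₂ B | inj₂ C = inj₂ (go A B C)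
    where
    b<a : b F.< a
    b<a = subst₂ _<_ (sym ≡b) (sym ≡a) ℕP.≤-refl
    c<b : c F.< b
    c<b = subst₂ _<_ (sym ≡c) (sym ≡b) ℕP.≤-refl
    p≤c : p ≤ toℕ c
    p≤c = ℕP.≤-reflexive (sym ≡c)
    p≤b : p ≤ toℕ b
    p≤b = ℕP.≤-trans p≤c (ℕP.<⇒≤ c<b)
    c<a : c F.< a
    c<a = FP.<-trans c<b b<a
    go : _ → _ → _ → Fork _ p
    go (inj₁ A) (inj₁ B) _        = forkNear F b<a a<q p≤b A B
    go (inj₁ A) (inj₂ _) (inj₁ C) = forkNear F c<a a<q p≤c A C
    go (inj₁ _) (inj₂ B) (inj₂ C) = forkFar F c<b b<q p≤c B C
    go (inj₂ A) (inj₂ B) _        = forkFar F b<a a<q p≤b A B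
    go (inj₂ A) (inj₁ _) (inj₂ C) = forkFar F c<a a<q p≤c A C
    go (inj₂ _) (inj₁ B) (inj₁ C) = forkNear F c<b b<q p≤c B C

  iterate : ∀ d → Fork m (d * 3 + p) → RedDense k₀ (suc k₀) 3 χ ⊎ Fork (d + m) p
  iterate zero    F = inj₂ F
  iterate {m} {p} (suc d) F with advance F
  ... | inj₁ R  = inj₁ R
  ... | inj₂ F′ = Sum.map₂ (subst (λ m → Fork m p) (ℕP.+-suc d m)) (iterate d F′)

  -- With at most k - 1 vertices no window is complete, so the top `c` vertices form a path in any
  -- colouring.
  initialPath : ∀ c → c ≤ 2 + h → p + c ≡ N →
                Σ (List (Fin N)) λ xs → length xs ≡ c × All (λ x → p ≤ toℕ x) xs × Path k₀ χ xs
  initialPath zero _ _ = [] , refl , [] , []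
  initialPath {p} (suc c) c<2+h p+c≡N
    with initialPath c (ℕP.<⇒≤ c<2+h) (trans (sym (ℕP.+-suc p c)) p+c≡N)
  ... | xs , refl , p<xs , P = fromℕ< p<N ∷ xs , refl ,
        ℕP.≤-reflexive (sym toℕ≡p) ∷ All.map ℕP.<⇒≤ p<xs ,
        extend-short (All.map (subst (_< _) (sym toℕ≡p)) p<xs) c<2+h P
    where
    p<N : p < N
    p<N = subst (p <_) p+c≡N (ℕP.m<m+n p z<s)
    toℕ≡p = FP.toℕ-fromℕ< p<N

  -- The top k - 2 vertices serve as `W` and the next two, `p` and `1 + p`, as options. Each option
  -- makes a path on k - 1 vertices, too few for an edge.
  initialFork : p + (3 + h) ≡ N → Fork (suc h) p
  initialFork {p} p+k≡N with initialPath {2 + p} (suc h) (ℕP.n≤1+n _) (trans eq p+k≡N)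
    where eq : 2 + p + suc h ≡ p + (3 + h)
          eq = trans (cong suc (sym (ℕP.+-suc p (suc h)))) (sym (ℕP.+-suc p (2 + h)))
  ... | W , ∣W∣ , q<W , P = fork W (fromℕ< p<N) (fromℕ< 1+p<N)
      (ℕP.≤-reflexive (sym ∣W∣)) (ℕP.≤-reflexive (sym ∣W∣)) (ℕP.≤-reflexive (sym toℕ≡p))
      (subst₂ _<_ (sym toℕ≡p) (sym toℕ≡1+p) ℕP.≤-refl)
      (extend-short (All.map (λ {x} 2+p≤x → subst (_< toℕ x) (sym toℕ≡p) (ℕP.<⇒≤ 2+p≤x)) q<W) short P)
      (extend-short (All.map (λ {x} 2+p≤x → subst (_< toℕ x) (sym toℕ≡1+p) 2+p≤x) q<W) short P)
    where
    short : length W < 2 + h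
    short = ℕP.≤-reflexive (cong suc ∣W∣)
    1+p<N : 1 + p < N
    1+p<N = subst (1 + p <_) p+k≡N (subst (_< p + (3 + h)) (ℕP.+-comm p 1) (ℕP.+-monoʳ-< p (s≤s (s≤s z≤n))))
    p<N : p < N
    p<N = ℕP.<⇒≤ 1+p<N
    toℕ≡p = FP.toℕ-fromℕ< p<N
    toℕ≡1+p = FP.toℕ-fromℕ< 1+p<N

-- The vertex count for n = k + d: k for the initial fork, three for each of d advances, one for the
-- last prepended vertex. After the advances m is d + k - 2, and `finishFork` adds two.
arrows : ∀ h d → Arrows (3 + h) (4 + h) 3 (3 + h + d) (d * 3 + 1 + (3 + h))
arrows h d χ with iterate d (initialFork {χ = χ} {p = d * 3 + 1} refl)
... | inj₁ R = inj₂ R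
... | inj₂ F with vertex-below F z<s
...   | _ , _ , r<q = Sum.swap (Sum.map₂ (subst (λ n → BluePath (3 + h) n χ) eq) (finishFork F r<q))
  where eq : 2 + (d + suc h) ≡ 3 + h + d
        eq = cong (2 +_) (ℕP.+-comm d (suc h))

-- Lower bounds: colourings of increasing lists of naturals

module _ {A : Set} where

  lookup-injective : {xs : List A} → Unique xs → ∀ {i j} → lookup xs i ≡ lookup xs j → i ≡ j
  lookup-injective (_ ∷ _)    {zero}  {zero}  _  = refl
  lookup-injective (x∉xs ∷ _) {zero}  {suc j} eq = contradiction eq (All.lookup x∉xs (∈-lookup j))
  lookup-injective (x∉xs ∷ _) {suc i} {zero}  eq = contradiction (sym eq) (All.lookup x∉xs (∈-lookup i))
  lookup-injective (_ ∷ xs!)  {suc i} {suc j} eq = cong suc (lookup-injective xs! eq)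

  Unique-length-≤ : {xs ys : List A} → Unique xs → All (_∈ₗ ys) xs → length xs ≤ length ys
  Unique-length-≤ {xs} {ys} xs! xs⊆ys = FP.injective⇒≤ {f = λ i → index (in-ys i)} λ {i} {j} eq →
    lookup-injective xs! (index-injective (setoid A) (in-ys i) (in-ys j) eq)
    where
    in-ys : ∀ i → lookup xs i ∈ₗ ys
    in-ys i = All.lookup xs⊆ys (∈-lookup i)

  -- On an increasing list of k + 1 vertices these are its k-subsets, ordered by the omitted entry
  -- from first to last; the sparsity proofs evaluate colours in this order.
  removals : List A → List (List A)
  removals []       = []
  removals (x ∷ xs) = xs ∷ map (x ∷_) (removals xs)

  ∈-removals : {xs ys : List A} → xs ⊆ₗ ys → suc (length xs) ≡ length ys → xs ∈ₗ removals ys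
  ∈-removals (y ∷ʳ xs⊆ys)   eq = here (Pointwise-≡⇒≡ (to-≋ (ℕP.suc-injective eq) xs⊆ys))
  ∈-removals (refl ∷ xs⊆ys) eq = there (∈-map⁺ _ (∈-removals xs⊆ys (ℕP.suc-injective eq)))

-- Colourings are defined on lists of naturals and pulled back along this map, so that one function
-- colours every `Fin N`.
elements : Subset N → List ℕ
elements []            = []
elements (inside  ∷ p) = 0 ∷ map suc (elements p)
elements (outside ∷ p) = map suc (elements p)

elements-increasing : (p : Subset N) → AllPairs _<_ (elements p)
elements-increasing []            = []
elements-increasing (inside  ∷ p) = AllP.map⁺ (All.universal (λ _ → z<s) _)
                                  ∷ AllPairsP.map⁺ (AllPairs.map s<s (elements-increasing p))
elements-increasing (outside ∷ p) = AllPairsP.map⁺ (AllPairs.map s<s (elements-increasing p))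

length-elements : (p : Subset N) → length (elements p) ≡ ∣ p ∣
length-elements []            = refl
length-elements (inside  ∷ p) = cong suc (trans (length-map suc (elements p)) (length-elements p))
length-elements (outside ∷ p) = trans (length-map suc (elements p)) (length-elements p)

elements-⊆ : {p q : Subset N} → p ⊆ q → elements p ⊆ₗ elements q
elements-⊆ {p = []}          {[]}          _   = []
elements-⊆ {p = inside  ∷ p} {inside  ∷ q} p⊆q = refl ∷ map⁺ suc (elements-⊆ (drop-∷-⊆ p⊆q))
elements-⊆ {p = inside  ∷ p} {outside ∷ q} p⊆q with () ← p⊆q here
elements-⊆ {p = outside ∷ p} {inside  ∷ q} p⊆q = 0 ∷ʳ map⁺ suc (elements-⊆ (drop-∷-⊆ p⊆q))
elements-⊆ {p = outside ∷ p} {outside ∷ q} p⊆q = map⁺ suc (elements-⊆ (drop-∷-⊆ p⊆q))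

∈-elements⁺ : ∀ {v} {p : Subset N} → v ∈ p → toℕ v ∈ₗ elements p
∈-elements⁺ here                            = here refl
∈-elements⁺ {p = inside  ∷ p} (there v∈) = there (∈-map⁺ suc (∈-elements⁺ v∈))
∈-elements⁺ {p = outside ∷ p} (there v∈) = ∈-map⁺ suc (∈-elements⁺ v∈)

∈-elements⁻ : ∀ {a} (p : Subset N) → a ∈ₗ elements p → ∃[ v ] (v ∈ p × toℕ v ≡ a)
∈-elements⁻ (inside ∷ p) (here refl) = zero , here , refl
∈-elements⁻ (inside ∷ p) (there a∈) with ∈-map⁻ suc a∈
... | b , b∈ , refl with ∈-elements⁻ p b∈
...   | v , v∈ , refl = suc v , there v∈ , refl
∈-elements⁻ (outside ∷ p) a∈ with ∈-map⁻ suc a∈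
... | b , b∈ , refl with ∈-elements⁻ p b∈
...   | v , v∈ , refl = suc v , there v∈ , refl

elements-injective : {p q : Subset N} → elements p ≡ elements q → p ≡ q
elements-injective eq = ⊆-antisym (sub eq) (sub (sym eq))
  where
  sub : {p q : Subset N} → elements p ≡ elements q → p ⊆ q
  sub {q = q} eq v∈ with ∈-elements⁻ q (subst (_ ∈ₗ_) eq (∈-elements⁺ v∈))
  ... | w , w∈ , w≡v = subst (_∈ q) (FP.toℕ-injective w≡v) w∈

-- Each head is the minimum of its list, so the heads bound each other; strictness keeps the common
-- head out of both tails.
increasing-unique : {as bs : List ℕ} → AllPairs _<_ as → AllPairs _<_ bs →
                    (∀ {c} → c ∈ₗ as → c ∈ₗ bs) → (∀ {c} → c ∈ₗ bs → c ∈ₗ as) → as ≡ bs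
increasing-unique [] [] _ _ = refl
increasing-unique [] (_ ∷ _) _ bs⊆ with () ← bs⊆ (here refl)
increasing-unique (_ ∷ _) [] as⊆ _ with () ← as⊆ (here refl)
increasing-unique {a ∷ as} {b ∷ bs} (a<as ∷ as<) (b<bs ∷ bs<) as⊆ bs⊆ =
  cong₂ _∷_ a≡b (increasing-unique as< bs< (λ c∈ → tail⊆ (All.lookup a<as c∈) a≡b (as⊆ (there c∈)))
                                          (λ c∈ → tail⊆ (All.lookup b<bs c∈) (sym a≡b) (bs⊆ (there c∈))))
  where
  head-≤ : ∀ {c d ds} → All (d <_) ds → c ∈ₗ d ∷ ds → d ≤ c
  head-≤ _    (here refl) = ℕP.≤-refl
  head-≤ d<ds (there c∈)  = ℕP.<⇒≤ (All.lookup d<ds c∈)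
  a≡b : a ≡ b
  a≡b = ℕP.≤-antisym (head-≤ a<as (bs⊆ (here refl))) (head-≤ b<bs (as⊆ (here refl)))
  tail⊆ : ∀ {c d e ds} → e < c → e ≡ d → c ∈ₗ d ∷ ds → c ∈ₗ ds
  tail⊆ e<c refl (here refl) = contradiction e<c (ℕP.<-irrefl refl)
  tail⊆ _   _    (there c∈)  = c∈

-- The value for i ≥ n is junk.
extendℕ : (Fin n → Fin N) → ℕ → ℕ
extendℕ {n} x i with i <? n
... | yes i<n = toℕ (x (fromℕ< i<n))
... | no  _   = 0

extendℕ-toℕ : (x : Fin n → Fin N) {i : ℕ} (i<n : i < n) → extendℕ x i ≡ toℕ (x (fromℕ< i<n))
extendℕ-toℕ {n} x {i} i<n with i <? n
... | yes i<n′ = cong (toℕ ∘ x) (FP.fromℕ<-cong i i refl i<n′ i<n)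
... | no  i≮n  = contradiction i<n i≮n

extendℕ-increasing : {x : Fin n → Fin N} → Increasing x → ∀ {i j} → i < j → j < n → extendℕ x i < extendℕ x j
extendℕ-increasing {x = x} x< {i} {j} i<j j<n =
  subst₂ _<_ (sym (extendℕ-toℕ x i<n)) (sym (extendℕ-toℕ x j<n))
    (x< _ _ (subst₂ _<_ (sym (FP.toℕ-fromℕ< i<n)) (sym (FP.toℕ-fromℕ< j<n)) i<j))
  where i<n = ℕP.<-trans i<j j<n

-- Both lists are increasing, so comparing members suffices. The index is `i + j`, not `j + i`, so
-- that at numerals `i` it reduces and an edge unfolds to the values at `j`, `1 + j`, `2 + j` and so
-- on.
elements-window : ∀ {x : Fin n → Fin N} → Increasing x → ∀ k j → j + k ≤ n →
                  elements (window k x j) ≡ applyUpTo (λ i → extendℕ x (i + j)) k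
elements-window {n} {N} {x} x< k j j+k≤n = increasing-unique (elements-increasing (window k x j))
  (AllPairsP.applyUpTo⁺₁ _ k λ i<i′ i′<k →
    extendℕ-increasing x< (ℕP.+-monoˡ-< j i<i′) (ℕP.<-≤-trans (i+j<j+k i′<k) j+k≤n))
  to from
  where
  i+j<j+k : ∀ {i} → i < k → i + j < j + k
  i+j<j+k {i} i<k = subst (_< j + k) (ℕP.+-comm j i) (ℕP.+-monoʳ-< j i<k)
  to : ∀ {c} → c ∈ₗ elements (window k x j) → c ∈ₗ applyUpTo (λ i → extendℕ x (i + j)) k
  to c∈ with ∈-elements⁻ (window k x j) c∈
  ... | v , v∈ , refl with ∈-window⁻ {x = x} {k = k} v∈
  ...   | i , j≤i , i<j+k , refl = subst (_∈ₗ _) eq (∈-applyUpTo⁺ _ i∸j<k)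
    where
    i∸j<k : toℕ i ∸ j < k
    i∸j<k = subst (toℕ i ∸ j <_) (ℕP.m+n∸m≡n j k) (ℕP.∸-monoˡ-< i<j+k j≤i)
    eq : extendℕ x ((toℕ i ∸ j) + j) ≡ toℕ (x i)
    eq = trans (cong (extendℕ x) (ℕP.m∸n+n≡m j≤i))
               (trans (extendℕ-toℕ x (FP.toℕ<n i)) (cong (toℕ ∘ x) (FP.fromℕ<-toℕ i (FP.toℕ<n i))))
  from : ∀ {c} → c ∈ₗ applyUpTo (λ i → extendℕ x (i + j)) k → c ∈ₗ elements (window k x j)
  from c∈ with ∈-applyUpTo⁻ _ c∈
  ... | i , i<k , refl = subst (_∈ₗ _) (sym (extendℕ-toℕ x i+j<n))
    (∈-elements⁺ (∈-window⁺ {x = x} {k = k} (subst (j ≤_) (sym ≡i+j) (ℕP.m≤n+m j i))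
                            (subst (_< j + k) (sym ≡i+j) (i+j<j+k i<k)) refl))
    where i+j<n = ℕP.<-≤-trans (i+j<j+k i<k) j+k≤n
          ≡i+j = FP.toℕ-fromℕ< i+j<n

redCount : Colour → ℕ
redCount red  = 1
redCount blue = 0

redCount≤1 : ∀ c → redCount c ≤ 1
redCount≤1 red  = ℕP.≤-refl
redCount≤1 blue = z≤n

isRed? : (c : Colour) → Dec (c ≡ red)
isRed? red  = yes refl
isRed? blue = no λ ()

module _ {A : Set} (g : A → Colour) where

  totalRed : List A → ℕ
  totalRed xs = sum (map (redCount ∘ g) xs)

  length-filter-red : (xs : List A) → length (filter (isRed? ∘ g) xs) ≡ totalRed xs
  length-filter-red []       = refl
  length-filter-red (x ∷ xs) with g x
  ... | red  = cong suc (length-filter-red xs)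
  ... | blue = length-filter-red xs

-- Distinct red subsets of `S` give distinct red entries of `removals (elements S)`. Density thus
-- becomes a sum of k + 1 terms that can be evaluated case by case.
RedDense⇒totalRed : ∀ {k t} (g : List ℕ → Colour) → RedDense {N} k (suc k) t (g ∘ elements) →
                    ∃[ as ] (AllPairs _<_ as × length as ≡ suc k × t ≤ totalRed g (removals as))
RedDense⇒totalRed {N} {k} {t} g (S , ∣S∣ , L , L! , t≤ , reds) =
  elements S , elements-increasing S , ∣elS∣ , (begin
    t                                                  ≤⟨ t≤ ⟩
    length L                                           ≡⟨ sym (length-map elements L) ⟩
    length (map elements L)                            ≤⟨ Unique-length-≤ (UniqueP.map⁺ elements-injective L!)
                                                             (AllP.map⁺ (All.map in-red reds)) ⟩
    length (filter (isRed? ∘ g) (removals (elements S))) ≡⟨ length-filter-red g (removals (elements S)) ⟩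
    totalRed g (removals (elements S))                 ∎)
  where
  open ℕP.≤-Reasoning
  ∣elS∣ = trans (length-elements S) ∣S∣
  in-red : ∀ {T} → T ⊆ S × ∣ T ∣ ≡ k × g (elements T) ≡ red →
           elements T ∈ₗ filter (isRed? ∘ g) (removals (elements S))
  in-red {T} (T⊆S , ∣T∣ , isRed) = ∈-filter⁺ (isRed? ∘ g)
    (∈-removals (elements-⊆ T⊆S) (trans (cong suc (trans (length-elements T) ∣T∣)) (sym ∣elS∣))) isRed

-- Indexing by ℕ lets a path be cut and shifted without conversions between `Fin` types.
record BlueSequence (g : List ℕ → Colour) (k n N : ℕ) : Set where
  field
    y      : ℕ → ℕ
    y-mono : ∀ {i j} → i < j → j < n → y i < y j
    y<N    : ∀ {i} → i < n → y i < N
    y-blue : ∀ j → j + k ≤ n → g (applyUpTo (λ i → y (i + j)) k) ≡ blue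

BluePath⇒BlueSequence : ∀ {g} → BluePath {N} k n (g ∘ elements) → BlueSequence g k n N
BluePath⇒BlueSequence {k = k} {g = g} (x , x< , isBlue) = record
  { y      = extendℕ x
  ; y-mono = extendℕ-increasing x<
  ; y<N    = λ i<n → subst (_< _) (sym (extendℕ-toℕ x i<n)) (FP.toℕ<n _)
  ; y-blue = λ j j+k≤n → trans (cong g (sym (elements-window x< k j j+k≤n))) (isBlue j j+k≤n)
  }

lower-bound : ∀ {M t} (g : List ℕ → Colour) →
              (∀ {N} → N < M → ¬ BlueSequence g k n N) →
              (∀ {as} → AllPairs _<_ as → length as ≡ suc k → totalRed g (removals as) < t) →
              r≥ k (suc k) t n M
lower-bound g no-path sparse N N<M arr with arr (g ∘ elements)
... | inj₁ path = no-path N<M (BluePath⇒BlueSequence path)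
... | inj₂ dense with RedDense⇒totalRed g dense
...   | as , as< , ∣as∣ , t≤ = ℕP.<⇒≱ (sparse as< ∣as∣) t≤

-- The block colouring for k = 3

pairColour : List ℕ → Colour
pairColour (a ∷ b ∷ _ ∷ []) = if does (⌊ a /2⌋ ≟ ⌊ b /2⌋) then red else blue
pairColour _                = blue

module _ {a b : ℕ} where

  pairColour-red : ⌊ a /2⌋ ≡ ⌊ b /2⌋ → ∀ {c} → pairColour (a ∷ b ∷ c ∷ []) ≡ red
  pairColour-red a~b rewrite dec-true (⌊ a /2⌋ ≟ ⌊ b /2⌋) a~b = refl

  pairColour-blue : ⌊ a /2⌋ ≢ ⌊ b /2⌋ → ∀ {c} → pairColour (a ∷ b ∷ c ∷ []) ≡ blue
  pairColour-blue a≁b rewrite dec-false (⌊ a /2⌋ ≟ ⌊ b /2⌋) a≁b = refl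

-- Since a + 2 ≤ c, the vertices a and c lie in different blocks, so b shares a block with at most
-- one of them. If with a, the two triples starting with a, b are red; if with c, only b, c, d is.
pairColour-sparse : ∀ {as} → AllPairs _<_ as → length as ≡ 4 → totalRed pairColour (removals as) < 3
pairColour-sparse {a ∷ b ∷ c ∷ d ∷ []} ((a<b ∷ _) ∷ (b<c ∷ _) ∷ _) refl
  with ⌊ b /2⌋ ≟ ⌊ c /2⌋ | ⌊ a /2⌋ ≟ ⌊ c /2⌋ | ⌊ a /2⌋ ≟ ⌊ b /2⌋
... | _ | yes a~c | _ = contradiction a~c (ℕP.<⇒≢ (ℕP.⌊n/2⌋-mono (ℕP.≤-trans (s≤s a<b) b<c)))
... | yes b~c | no a≁c | yes a~b = contradiction (trans a~b b~c) a≁c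
... | yes b~c | no a≁c | no a≁b
  rewrite pairColour-red b~c {d} | pairColour-blue a≁c {d} | pairColour-blue a≁b {d}
  = s≤s (s≤s z≤n)
... | no b≁c  | no a≁c | yes a~b
  rewrite pairColour-blue b≁c {d} | pairColour-blue a≁c {d} | pairColour-red a~b {d}
  = ℕP.≤-refl
... | no b≁c  | no a≁c | no a≁b
  rewrite pairColour-blue b≁c {d} | pairColour-blue a≁c {d} | pairColour-blue a≁b {d}
  = z<s

pairColour-blue⁻ : ∀ {a b c} → a < b → pairColour (a ∷ b ∷ c ∷ []) ≡ blue → ⌊ a /2⌋ < ⌊ b /2⌋
pairColour-blue⁻ {a} {b} {c} a<b isBlue = ℕP.≤∧≢⇒< (ℕP.⌊n/2⌋-mono (ℕP.<⇒≤ a<b))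
  λ a~b → contradiction (trans (sym (pairColour-red a~b {c})) isBlue) λ ()

-- With n = 3 + d, the edges starting at positions 0 to d force the block number up at each step, so
-- the vertex at position n - 2 is at least 2(n - 2). The last vertex is only known to be larger,
-- which gives N ≥ 2n - 2.
pairColour-path : ∀ d → N < 2 * (3 + d) ∸ 2 → ¬ BlueSequence pairColour 3 (3 + d) N
pairColour-path {N} d N< S = ℕP.<⇒≱ N< (begin
  2 * (3 + d) ∸ 2                   ≡⟨ cong (_∸ 2) (eq d) ⟩
  2 + (suc d + suc d)               ≤⟨ ℕP.+-monoʳ-≤ 2 (ℕP.+-mono-≤ half half) ⟩
  2 + (⌊ y (suc d) /2⌋ + ⌊ y (suc d) /2⌋) ≤⟨ ℕP.+-monoʳ-≤ 2 (ℕP.+-monoʳ-≤ _ (ℕP.⌊n/2⌋≤⌈n/2⌉ (y (suc d)))) ⟩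
  2 + (⌊ y (suc d) /2⌋ + ⌈ y (suc d) /2⌉) ≡⟨ cong (2 +_) (ℕP.⌊n/2⌋+⌈n/2⌉≡n (y (suc d))) ⟩
  2 + y (suc d)                     ≤⟨ s≤s (y-mono ℕP.≤-refl ℕP.≤-refl) ⟩
  suc (y (2 + d))                   ≤⟨ y<N ℕP.≤-refl ⟩
  N                                 ∎)
  where
  open BlueSequence S
  open ℕP.≤-Reasoning
  eq : ∀ d → 2 * (3 + d) ≡ 4 + (suc d + suc d)
  eq = solve-∀
  halves : ∀ i → i ≤ suc d → i ≤ ⌊ y i /2⌋
  halves zero    _     = z≤n
  halves (suc i) i<1+d = ℕP.≤-<-trans (halves i (ℕP.<⇒≤ i<1+d))
    (pairColour-blue⁻ {c = y (2 + i)} (y-mono ℕP.≤-refl (s≤s (ℕP.m≤n⇒m≤1+n i<1+d)))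
      (y-blue i (subst (_≤ 3 + d) (ℕP.+-comm 3 i) (s≤s (s≤s i<1+d)))))
  half = halves (suc d) ℕP.≤-refl

-- The dyadic colouring for k = 4

-- Splits the interval [o , o + 2 ^ m) at its midpoint; a 4-set is red iff the first split that
-- separates it has two elements on each side.
dyadic : (m o a b c d : ℕ) → Colour
dyadic zero    o a b c d = blue
dyadic (suc m) o a b c d =
  if does (d <? mid) then dyadic m o a b c d
  else if does (a <? mid) then (if does (b <? mid) ∧ not (does (c <? mid)) then red else blue)
  else dyadic m mid a b c d
  where mid = o + 2 ^ m

-- dyadic-ij: i of the four elements lie below the midpoint and j above it.
module _ (m o : ℕ) {a b c d : ℕ} where

  private
    mid : ℕ
    mid = o + 2 ^ m

  dyadic-40 : d < mid → dyadic (suc m) o a b c d ≡ dyadic m o a b c d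
  dyadic-40 d< rewrite dec-true (d <? mid) d< = refl

  dyadic-31 : a < mid → c < mid → ¬ d < mid → dyadic (suc m) o a b c d ≡ blue
  -- The side of `b` is left open: with `c` below the midpoint both outcomes are blue.
  dyadic-31 a< c< d≮ rewrite dec-false (d <? mid) d≮ | dec-true (a <? mid) a< | dec-true (c <? mid) c<
    with does (b <? mid)
  ... | true  = refl
  ... | false = refl

  dyadic-22 : a < mid → b < mid → ¬ c < mid → ¬ d < mid → dyadic (suc m) o a b c d ≡ red
  dyadic-22 a< b< c≮ d≮ rewrite dec-false (d <? mid) d≮ | dec-true (a <? mid) a<
    | dec-true (b <? mid) b< | dec-false (c <? mid) c≮ = refl

  dyadic-13 : a < mid → ¬ b < mid → ¬ d < mid → dyadic (suc m) o a b c d ≡ blue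
  dyadic-13 a< b≮ d≮ rewrite dec-false (d <? mid) d≮ | dec-true (a <? mid) a<
    | dec-false (b <? mid) b≮ = refl

  dyadic-04 : ¬ a < mid → ¬ d < mid → dyadic (suc m) o a b c d ≡ dyadic m mid a b c d
  dyadic-04 a≮ d≮ rewrite dec-false (d <? mid) d≮ | dec-false (a <? mid) a≮ = refl

dyadicColour : ℕ → ℕ → List ℕ → Colour
dyadicColour m o (a ∷ b ∷ c ∷ d ∷ []) = dyadic m o a b c d
dyadicColour m o _                    = blue

-- Consider how the midpoint splits the five vertices. A 5-0 split recurses. A 4-1 split leaves only
-- the 4-set on the larger side possibly red. In a 3-2 split exactly the three 4-sets omitting a
-- vertex of the larger side are red. At `m` = 0 the default blue makes the claim trivial, so no
-- range hypothesis is carried.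
dyadicColour-sparse : ∀ m o {as} → AllPairs _<_ as → length as ≡ 5 →
                      totalRed (dyadicColour m o) (removals as) < 4
dyadicColour-sparse zero    o {_ ∷ _ ∷ _ ∷ _ ∷ _ ∷ []} _ refl = z<s
dyadicColour-sparse (suc m) o {a ∷ b ∷ c ∷ d ∷ e ∷ []}
  as<@((a<b ∷ _) ∷ (b<c ∷ _) ∷ (c<d ∷ _) ∷ (d<e ∷ _) ∷ _) refl
  with e <? o + 2 ^ m | d <? o + 2 ^ m | c <? o + 2 ^ m | b <? o + 2 ^ m | a <? o + 2 ^ m
-- The first four clauses discard the comparison patterns that contradict the order of the vertices.
... | yes e< | no d≮ | _ | _ | _ = contradiction (ℕP.<-trans d<e e<) d≮
... | _ | yes d< | no c≮ | _ | _ = contradiction (ℕP.<-trans c<d d<) c≮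
... | _ | _ | yes c< | no b≮ | _ = contradiction (ℕP.<-trans b<c c<) b≮
... | _ | _ | _ | yes b< | no a≮ = contradiction (ℕP.<-trans a<b b<) a≮
... | yes e< | yes d< | yes _ | yes _ | yes _
  rewrite dyadic-40 m o {b} {c} {d} e< | dyadic-40 m o {a} {c} {d} e< | dyadic-40 m o {a} {b} {d} e<
        | dyadic-40 m o {a} {b} {c} e< | dyadic-40 m o {a} {b} {c} d< = dyadicColour-sparse m o as< refl
... | no e≮ | yes d< | yes c< | yes b< | yes a<
  rewrite dyadic-31 m o {b} {c} b< d< e≮ | dyadic-31 m o {a} {c} a< d< e≮ | dyadic-31 m o {a} {b} a< d< e≮
        | dyadic-31 m o {a} {b} a< c< e≮ | ℕP.+-identityʳ (redCount (dyadic (suc m) o a b c d))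
  = ℕP.≤-trans (s≤s (redCount≤1 _)) (s≤s (s≤s z≤n))
... | no e≮ | no d≮ | yes c< | yes b< | yes a<
  rewrite dyadic-22 m o b< c< d≮ e≮ | dyadic-22 m o a< c< d≮ e≮ | dyadic-22 m o a< b< d≮ e≮
        | dyadic-31 m o {a} {b} a< c< e≮ | dyadic-31 m o {a} {b} a< c< d≮ = ℕP.≤-refl
... | no e≮ | no d≮ | no c≮ | yes b< | yes a<
  rewrite dyadic-13 m o {b} {c} {d} b< c≮ e≮ | dyadic-13 m o {a} {c} {d} a< c≮ e≮ | dyadic-22 m o a< b< d≮ e≮
        | dyadic-22 m o a< b< c≮ e≮ | dyadic-22 m o a< b< c≮ d≮ = ℕP.≤-refl
... | no e≮ | no d≮ | no c≮ | no b≮ | yes a<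
  rewrite dyadic-13 m o {a} {c} {d} a< c≮ e≮ | dyadic-13 m o {a} {b} {d} a< b≮ e≮
        | dyadic-13 m o {a} {b} {c} a< b≮ e≮ | dyadic-13 m o {a} {b} {c} a< b≮ d≮
        | ℕP.+-identityʳ (redCount (dyadic (suc m) o b c d e))
  = ℕP.≤-trans (s≤s (redCount≤1 _)) (s≤s (s≤s z≤n))
... | no e≮ | no d≮ | no _ | no b≮ | no a≮
  rewrite dyadic-04 m o {b} {c} {d} b≮ e≮ | dyadic-04 m o {a} {c} {d} a≮ e≮ | dyadic-04 m o {a} {b} {d} a≮ e≮
        | dyadic-04 m o {a} {b} {c} a≮ e≮ | dyadic-04 m o {a} {b} {c} a≮ d≮
  = dyadicColour-sparse m (o + 2 ^ m) as< refl

-- A part of a blue path inside one dyadic interval; the offset `o` varies so that both pieces of a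
-- path cut at the midpoint are again of this form.
record BlueRun (m o ℓ : ℕ) (y : ℕ → ℕ) : Set where
  field
    y≥     : ∀ {i} → i < ℓ → o ≤ y i
    y<     : ∀ {i} → i < ℓ → y i < o + 2 ^ m
    y-mono : ∀ {i j} → i < j → j < ℓ → y i < y j
    y-blue : ∀ i → 4 + i ≤ ℓ → dyadic m o (y i) (y (1 + i)) (y (2 + i)) (y (3 + i)) ≡ blue

-- Monotonicity makes the terms below `t` an initial segment.
crossing : ∀ t ℓ {y : ℕ → ℕ} → (∀ {i j} → i < j → j < ℓ → y i < y j) →
           ∃₂ λ p r → p + r ≡ ℓ × (∀ {i} → i < p → y i < t) × (∀ {i} → i < r → ¬ y (i + p) < t)
crossing t zero    _ = 0 , 0 , refl , (λ ()) , (λ ())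
crossing t (suc ℓ) {y} y-mono with y 0 <? t
... | no y₀≮t = 0 , suc ℓ , refl , (λ ()) , above
  where
  above : ∀ {i} → i < suc ℓ → ¬ y (i + 0) < t
  above {zero}  _   = y₀≮t
  above {suc i} i<ℓ yᵢ<t =
    y₀≮t (ℕP.<-trans (y-mono z<s (subst (_< suc ℓ) (sym (ℕP.+-identityʳ (suc i))) i<ℓ)) yᵢ<t)
... | yes y₀<t with crossing t ℓ {y ∘ suc} (λ i<j j<ℓ → y-mono (s<s i<j) (s<s j<ℓ))
...   | p , r , refl , below , above = suc p , r , refl , below′ ,
        λ {i} i<r → subst (λ j → ¬ y j < t) (sym (ℕP.+-suc i p)) (above i<r)
  where
  below′ : ∀ {i} → i < suc p → y i < t
  below′ {zero}  _         = y₀<t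
  below′ {suc i} (s≤s i<p) = below i<p

-- A single point holds one vertex. For larger intervals, one half holds at most one vertex and
-- induction bounds the number in the other, so each doubling costs at most one.
BlueRun-length : ∀ m o {ℓ y} → BlueRun m o ℓ y → ℓ ≤ suc m
BlueRun-length zero o {zero}  R = z≤n
BlueRun-length zero o {suc zero} R = ℕP.≤-refl
BlueRun-length zero o {2+ ℓ} {y} R = contradiction (begin
    2 + o       ≤⟨ s≤s (s≤s (y≥ z<s)) ⟩
    2 + y 0     ≤⟨ s≤s (y-mono z<s (s<s z<s)) ⟩
    suc (y 1)   ≤⟨ y< (s<s z<s) ⟩
    o + 1       ≡⟨ ℕP.+-comm o 1 ⟩
    suc o       ∎) ℕP.1+n≰n
  where open BlueRun R
        open ℕP.≤-Reasoning
BlueRun-length (suc m) o {ℓ} {y} R with crossing (o + 2 ^ m) ℓ (BlueRun.y-mono R)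
... | p , r , refl , below , above = combine p r below above lowRun highRun y-blue
  where
  open BlueRun R
  lowRun : BlueRun m o p y
  lowRun = record
    { y≥     = λ i<p → y≥ (ℕP.m≤n⇒m≤n+o r i<p)
    ; y<     = below
    ; y-mono = λ i<j j<p → y-mono i<j (ℕP.m≤n⇒m≤n+o r j<p)
    ; y-blue = λ i i+4≤p → trans (sym (dyadic-40 m o (below i+4≤p))) (y-blue i (ℕP.m≤n⇒m≤n+o r i+4≤p))
    }
  shift : ∀ {i} → i < r → i + p < p + r
  shift {i} i<r = subst (i + p <_) (ℕP.+-comm r p) (ℕP.+-monoˡ-< p i<r)
  highRun : BlueRun m (o + 2 ^ m) r (λ i → y (i + p))
  highRun = record
    { y≥     = λ i<r → ℕP.≮⇒≥ (above i<r)
    ; y<     = λ {i} i<r → subst (y (i + p) <_) (trans (cong (λ z → o + (2 ^ m + z)) (ℕP.+-identityʳ (2 ^ m)))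
                                            (sym (ℕP.+-assoc o (2 ^ m) (2 ^ m)))) (y< (shift i<r))
    ; y-mono = λ i<j j<r → y-mono (ℕP.+-monoˡ-< p i<j) (shift j<r)
    ; y-blue = λ i i+4≤r → trans
        (sym (dyadic-04 m o (above (ℕP.≤-trans (ℕP.m≤n+m (suc i) 3) i+4≤r)) (above i+4≤r)))
        (y-blue (i + p) (shift i+4≤r))
    }
  combine : ∀ p r → (∀ {i} → i < p → y i < o + 2 ^ m) → (∀ {i} → i < r → ¬ y (i + p) < o + 2 ^ m) →
            BlueRun m o p y → BlueRun m (o + 2 ^ m) r (λ i → y (i + p)) →
            (∀ i → 4 + i ≤ p + r → dyadic (suc m) o (y i) (y (1 + i)) (y (2 + i)) (y (3 + i)) ≡ blue) →
            p + r ≤ 2 + m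
  combine 0 r _ _ _ H _ = ℕP.m≤n⇒m≤1+n (BlueRun-length m _ H)
  combine 1 r _ _ _ H _ = s≤s (BlueRun-length m _ H)
  combine p@(2+ _) 0 _ _ L _ _ =
    ℕP.m≤n⇒m≤1+n (subst (_≤ suc m) (sym (ℕP.+-identityʳ p)) (BlueRun-length m o L))
  combine p@(2+ _) 1 _ _ L _ _ = subst (_≤ 2 + m) (ℕP.+-comm 1 p) (s≤s (BlueRun-length m o L))
  -- With two vertices on each side, the window starting at position `p` takes the last two below
  -- the midpoint and the first two above it, and is red.
  combine (2+ p) (2+ r) below above _ _ isBlue = contradiction
    (trans (sym (dyadic-22 m o (below (ℕP.m<n+m p z<s)) (below ℕP.≤-refl) (above z<s) (above (s<s z<s))))
           (isBlue p (subst (4 + p ≤_) (eq p r) (ℕP.m≤m+n (4 + p) r))))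
    λ ()
    where
    eq : ∀ p r → 4 + p + r ≡ 2 + p + (2 + r)
    eq = solve-∀

-- As N ≤ 2 ^ m, the path would be a run in [0, 2 ^ m), where m + 1 vertices are the most possible.
dyadicColour-path : ∀ m → N < 2 ^ m + 1 → ¬ BlueSequence (dyadicColour m 0) 4 (2 + m) N
dyadicColour-path {N} m N< S = contradiction (BlueRun-length m 0 run) ℕP.1+n≰n
  where
  open BlueSequence S
  run : BlueRun m 0 (2 + m) y
  run = record
    { y≥     = λ _ → z≤n
    ; y<     = λ i<n → ℕP.<-≤-trans (y<N i<n) (s≤s⁻¹ (subst (N <_) (ℕP.+-comm (2 ^ m) 1) N<))
    ; y-mono = y-mono
    ; y-blue = λ i i+4≤ → y-blue i (subst (_≤ 2 + m) (ℕP.+-comm 4 i) i+4≤)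
    }

-- Comparison with the stated bounds

arrows-bound : ∀ h d → d * 3 + 1 + (3 + h) ≤ 16 * (3 + h + d)
-- The added term is the exact difference of the two sides.
arrows-bound h d = subst (d * 3 + 1 + (3 + h) ≤_) (eq h d) (ℕP.m≤m+n _ (44 + 15 * h + 13 * d))
  where
  eq : ∀ h d → d * 3 + 1 + (3 + h) + (44 + 15 * h + 13 * d) ≡ 16 * (3 + h + d)
  eq = solve-∀

-- At k = 3 the count 3n - 2k + 1 equals 3n - 5, one below the bound.
arrows-bound₃ : ∀ d → d * 3 + 1 + 3 ≤ 3 * (3 + d) ∸ 4
arrows-bound₃ d = subst (d * 3 + 1 + 3 ≤_) (cong (_∸ 4) (eq d)) (ℕP.n≤1+n (d * 3 + 1 + 3))
  where
  eq : ∀ d → 4 + suc (d * 3 + 1 + 3) ≡ 3 * (3 + d)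
  eq = solve-∀

theorem5 : (∀ (k n : ℕ) → 3 ≤ k → k ≤ n → r≤ k (suc k) 3 n (16 * n))
    × (∀ (n : ℕ) → 3 ≤ n → r≥ 3 4 3 n (2 * n ∸ 2) × r≤ 3 4 3 n (3 * n ∸ 4))
    × (∀ (n : ℕ) → 2 ≤ n → r≥ 4 5 4 n (2 ^ (n ∸ 2) + 1))
theorem5 = partA , partB , partC
  where
  partA : ∀ k n → 3 ≤ k → k ≤ n → r≤ k (suc k) 3 n (16 * n)
  partA k n 3≤k k≤n with ℕP.m≤n⇒∃[o]m+o≡n 3≤k | ℕP.m≤n⇒∃[o]m+o≡n k≤n
  ... | h , refl | d , refl = d * 3 + 1 + (3 + h) , arrows-bound h d , arrows h d
  partB : ∀ n → 3 ≤ n → r≥ 3 4 3 n (2 * n ∸ 2) × r≤ 3 4 3 n (3 * n ∸ 4)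
  partB n 3≤n with ℕP.m≤n⇒∃[o]m+o≡n 3≤n
  ... | d , refl = lower-bound {M = 2 * (3 + d) ∸ 2} {t = 3} pairColour
                     (pairColour-path d) pairColour-sparse ,
                   d * 3 + 1 + 3 , arrows-bound₃ d , arrows 0 d
  partC : ∀ n → 2 ≤ n → r≥ 4 5 4 n (2 ^ (n ∸ 2) + 1)
  partC n 2≤n with ℕP.m≤n⇒∃[o]m+o≡n 2≤n
  -- With n = 2 + m the exponent `n ∸ 2` reduces to `m`.
  ... | m , refl = lower-bound {M = 2 ^ m + 1} {t = 4} (dyadicColour m 0)
                 (dyadicColour-path m) (dyadicColour-sparse m 0)
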